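{- Let $D$ be a digraph on vertex set $V=\{1,\dots,n\}$ and let $p \ge 1$ be an integer. For every integer $q \ge 3$, $$\max \{ \operatorname{ima}(f^p): f \in F[D, q] \} = \max \{ \operatorname{ima}(f^p): f \in F(D, q) \} = \alpha_p(D).$$ Moreover, for $q=2$, $$\max \{ \operatorname{ima}(f^p): f \in F(D, 2) \} = \alpha_p(D).$$
   Context: A digraph $D=(V,E)$ has $V=\{1,\dots,n\}$ and $E\subseteq V^2$ (loops allowed, no repeated arcs). A walk of length $p$ ($p$-walk) is a sequence $(v_0,\dots,v_p)$ of vertices with $(v_s,v_{s+1})\in E$ for $0\le s\le p-1$. Two $p$-walks $(w_0,\dots,w_p)$, $(w'_0,\dots,w'_p)$ are independent if $w_s\ne w'_s$ for all $0\le s\le p$. $\alpha_p(D)$ is the maximum number of pairwise independent $p$-walks in $D$. Let $[q]=\{0,1,\dots,q-1\}$. For $f=(f_1,\dots,f_n):[q]^n\to[q]^n$, the interaction graph $\mathrm{IG}(f)$ is the digraph on $V$ with $(u,v)$ an arc iff $f_v$ depends essentially on $x_u$ (there exist $x,y\in[q]^n$ differing only in coordinate $u$ with $f_v(x)\ne f_v(y)$). $F[D,q]=\{f:[q]^n\to[q]^n : \mathrm{IG}(f)=D\}$ and $F(D,q)=\{f:[q]^n\to[q]^n : \mathrm{IG}(f)\subseteq D\}$. $f^1=f$, $f^{k+1}=f\circ f^k$. For a map $g$ with codomain $[q]^m$, $\operatorname{ima}(g)=\log_q|\mathrm{Im}(g)|$. -}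

module Defs where

open import Data.Nat using (ℕ; zero; suc; _^_; _≤_)
open import Data.Fin using (Fin; inject₁) renaming (suc to fsuc)
open import Data.Fin.Properties using () renaming (_≟_ to _≟ᶠ_)
open import Data.Bool using (Bool; true)
open import Data.Vec using (Vec; []; _∷_; lookup; _[_]≔_)
open import Data.Vec.Properties using (≡-dec)
open import Data.List using (List; [_]; map; concatMap; filter; length; allFin)
open import Data.List.Relation.Unary.Any using (any?)
open import Data.Product using (Σ; ∃; _×_; _,_)
open import Function.Bundles using (_⇔_)
open import Relation.Binary.PropositionalEquality using (_≡_; _≢_)

-- A digraph on vertex set Fin n (vertices 1..n are 0..n-1), given by its
-- adjacency relation (loops allowed; arcs are a set, so no repeated arcs).
Digraph : ℕ → Set
Digraph n = Fin n → Fin n → Bool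

Arc : ∀ {n} → Digraph n → Fin n → Fin n → Set
Arc D u v = D u v ≡ true

IsWalk : ∀ {n} → Digraph n → (p : ℕ) → (Fin (suc p) → Fin n) → Set
IsWalk D p w = (s : Fin p) → Arc D (w (inject₁ s)) (w (fsuc s))

Independent : ∀ {n p} → (Fin (suc p) → Fin n) → (Fin (suc p) → Fin n) → Set
Independent {p = p} w w' = (s : Fin (suc p)) → w s ≢ w' s

IndepWalks : ∀ {n} → Digraph n → (p m : ℕ) → Set
IndepWalks {n} D p m =
  Σ (Fin m → Fin (suc p) → Fin n) λ W →
    ((i : Fin m) → IsWalk D p (W i)) ×
    ((i j : Fin m) → i ≢ j → Independent (W i) (W j))

IsAlpha : ∀ {n} → Digraph n → (p k : ℕ) → Set
IsAlpha D p k = IndepWalks D p k × (∀ m → IndepWalks D p m → m ≤ k)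

Config : ℕ → ℕ → Set
Config q n = Vec (Fin q) n

Map : ℕ → ℕ → Set
Map q n = Config q n → Config q n

iter : ∀ {q n} → Map q n → ℕ → Map q n
iter f zero    x = x
iter f (suc k) x = f (iter f k x)

DependsOn : ∀ {q n} → Map q n → Fin n → Fin n → Set
DependsOn {q} f u v =
  ∃ λ (x : Config q _) → ∃ λ (a : Fin q) →
    lookup (f x) v ≢ lookup (f (x [ u ]≔ a)) v

IGEq : ∀ {q n} → Map q n → Digraph n → Set
IGEq f D = ∀ u v → (DependsOn f u v ⇔ Arc D u v)

IGSub : ∀ {q n} → Map q n → Digraph n → Set
IGSub f D = ∀ u v → DependsOn f u v → Arc D u v

allConfigs : (q n : ℕ) → List (Config q n)
allConfigs q zero    = [ [] ]
allConfigs q (suc n) = concatMap (λ a → map (a ∷_) (allConfigs q n)) (allFin q)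

-- |Im(g)| for g : [q]^n → [q]^n (so ima(g) = log_q imageSize g).
imageSize : ∀ {q n} → Map q n → ℕ
imageSize {q} {n} g =
  length (filter (λ y → any? (λ x → ≡-dec _≟ᶠ_ (g x) y) (allConfigs q n))
                 (allConfigs q n))

{-# OPTIONS --safe #-}
module Submission where

-- Give a pair (u, v) weight p if it is an arc, p − 1 if u = v is not an arc, and
-- 0 otherwise, and let π be a permutation of maximum total weight.  By
-- Egerváry's theorem there are α, β with α u + β v ≥ weight u v and equality
-- for v = π u.  The pairs (v, s) with p − α v ≤ s ≤ β v meet every p-walk, and
-- the states x_v at these times s determine f^p.  On the other hand the p-walks
-- that follow π along arcs are independent, and tightness of the potentials
-- shows that there are at least as many of them as pairs in the cut, so both
-- numbers equal α_p(D).  Finally, a map that copies along π realises q^α_p(D)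
-- images; for q ≥ 3 it can depend on all other in-neighbours through
-- conditional transpositions of 1 and 2, which do not move zeros.

open import Defs
open import Data.Bool using (Bool; true; false; _∧_; _∨_; not; if_then_else_)
open import Data.Bool.Properties using () renaming (_≟_ to _≟ᵇ_)
open import Data.Fin using (Fin; zero; suc; toℕ; fromℕ; fromℕ<; inject₁; splitAt; _↑ˡ_; _↑ʳ_;
  punchOut; combine; finToFun; funToFin)
open import Data.Fin.Induction using (<-weakInduction)
open import Data.Fin.Permutation using (Permutation′; permutation; _⟨$⟩ʳ_; _⟨$⟩ˡ_; inverseˡ)
open import Data.Fin.Properties using (_≟_; any?; all?; ¬∀⟶∃¬; splitAt-↑ˡ; splitAt-↑ʳ; join-splitAt;
  punchOut-injective; injective⇒≤; finToFun-funToFin; funToFin-finToFin;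
  toℕ-inject₁; toℕ-fromℕ<; toℕ-fromℕ; toℕ<n; toℕ-injective)
open import Data.List as List using (List; []; _∷_; concatMap; cartesianProductWith; length; allFin; filter)
open import Data.List.Membership.Propositional using (_∈_)
open import Data.List.Membership.Propositional.Properties
  using (∈-lookup; ∈-filter⁺; ∈-filter⁻; ∈-cartesianProductWith⁺; ∈-allFin)
open import Data.List.Membership.Setoid.Properties using (index-injective)
open import Data.List.Relation.Unary.All as All using ()
open import Data.List.Relation.Unary.AllPairs using ([]; _∷_)
open import Data.List.Relation.Unary.Any as Any using (here; index)
open import Data.List.Relation.Unary.Unique.Propositional using (Unique)
open import Data.List.Relation.Unary.Unique.Propositional.Properties
  using (cartesianProductWith⁺; allFin⁺; filter⁺)
open import Data.Nat using (ℕ; zero; suc; _+_; _∸_; _^_; _≤_; _<_; z≤n; s≤s; _≤?_; _<?_)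
open import Data.Nat.Induction using (<-wellFounded)
import Data.Nat.Properties as ℕ
open import Data.Nat.Properties hiding (_≟_)
open import Data.Nat.Tactic.RingSolver using (solve-∀)
open import Data.Product as Product using (Σ; ∃; _×_; _,_; proj₁; proj₂)
open import Data.Sum using (_⊎_; inj₁; inj₂; [_,_]′)
open import Data.Vec using (Vec; []; _∷_; lookup; tabulate; replicate; _[_]≔_)
open import Data.Vec.Properties
  using (≡-dec; ∷-injective; lookup∘tabulate; lookup∘update; lookup∘update′; lookup-replicate)
open import Data.Vec.Relation.Binary.Pointwise.Extensional using (ext; Pointwise-≡⇒≡)
open import Function using (_∘_; id)
open import Function.Bundles using (mk⇔)
open import Function.Definitions using (Injective)
open import Induction.WellFounded using (Acc; acc)
open import Relation.Binary.PropositionalEquality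
open import Relation.Nullary using (Dec; yes; no; does; contradiction)
open import Relation.Nullary.Decidable using (_×-dec_; _→-dec_; ¬?; dec-true; dec-false; does-⇔)
open import Algebra.Properties.CommutativeMonoid.Sum +-0-commutativeMonoid
  using (sum; sum-cong-≗; ∑-distrib-+; sum-replicate-zero; sum-permute)

private
  variable
    m n q : ℕ

-- Finite sums and cardinalities of subsets.

sum-mono : {f g : Fin n → ℕ} → (∀ i → f i ≤ g i) → sum f ≤ sum g
sum-mono {zero}  f≤g = z≤n
sum-mono {suc n} f≤g = +-mono-≤ (f≤g zero) (sum-mono (f≤g ∘ suc))

sum-mono-< : {f g : Fin n → ℕ} → (∀ i → f i ≤ g i) → ∀ i → f i < g i → sum f < sum g
sum-mono-< f≤g zero    fi<gi = +-mono-<-≤ fi<gi (sum-mono (f≤g ∘ suc))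
sum-mono-< f≤g (suc i) fi<gi = +-mono-≤-< (f≤g zero) (sum-mono-< (f≤g ∘ suc) i fi<gi)

sum-+-cong : (f g h k : Fin n → ℕ) → (∀ i → f i + g i ≡ h i + k i) →
             sum f + sum g ≡ sum h + sum k
sum-+-cong f g h k eq = trans (sym (∑-distrib-+ f g))
  (trans (sum-cong-≗ eq) (∑-distrib-+ h k))

does⇒ : {A : Set} (a? : Dec A) → does a? ≡ true → A
does⇒ (yes a) _ = a

bit : Bool → ℕ
bit true  = 1
bit false = 0

count : (Fin n → Bool) → ℕ
count S = sum (bit ∘ S)

⁅_⁆ : Fin n → Fin n → Bool
⁅ u ⁆ v = does (u ≟ v)

≡⇒∈⁅⁆ : {u v : Fin n} → u ≡ v → ⁅ u ⁆ v ≡ true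
≡⇒∈⁅⁆ {u = u} {v} = dec-true (u ≟ v)

≢⇒∉⁅⁆ : {u v : Fin n} → u ≢ v → ⁅ u ⁆ v ≡ false
≢⇒∉⁅⁆ {u = u} {v} = dec-false (u ≟ v)

∈⁅⁆⇒≡ : {u v : Fin n} → ⁅ u ⁆ v ≡ true → u ≡ v
∈⁅⁆⇒≡ {u = u} {v} = does⇒ (u ≟ v)

count-⁅⁆ : (u : Fin n) → count ⁅ u ⁆ ≡ 1
count-⁅⁆ {suc n} zero = cong suc (sum-replicate-zero n)
count-⁅⁆ (suc u)      = count-⁅⁆ u

count-∨-∧ : (S S' : Fin n → Bool) →
            count (λ i → S i ∨ S' i) + count (λ i → S i ∧ S' i) ≡ count S + count S'
count-∨-∧ S S' = sum-+-cong _ _ _ _ (λ i → bits (S i) (S' i))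
  where
  bits : ∀ a b → bit (a ∨ b) + bit (a ∧ b) ≡ bit a + bit b
  bits true  true  = refl
  bits true  false = refl
  bits false true  = refl
  bits false false = refl

count-delete : (S : Fin n → Bool) {u : Fin n} → S u ≡ true →
               count (λ i → S i ∧ not (⁅ u ⁆ i)) + 1 ≡ count S
count-delete S {u} Su = begin
  count (λ i → S i ∧ not (⁅ u ⁆ i)) + 1
    ≡⟨ cong (count (λ i → S i ∧ not (⁅ u ⁆ i)) +_) (count-⁅⁆ u) ⟨
  count (λ i → S i ∧ not (⁅ u ⁆ i)) + count ⁅ u ⁆
    ≡⟨ ∑-distrib-+ (λ i → bit (S i ∧ not (⁅ u ⁆ i))) _ ⟨
  sum (λ i → bit (S i ∧ not (⁅ u ⁆ i)) + bit (⁅ u ⁆ i)) ≡⟨ sum-cong-≗ pointwise ⟩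
  count S                                         ∎
  where
  open ≡-Reasoning
  pointwise : ∀ i → bit (S i ∧ not (⁅ u ⁆ i)) + bit (⁅ u ⁆ i) ≡ bit (S i)
  pointwise i with u ≟ i
  ... | yes refl rewrite Su = refl
  ... | no _ with S i
  ... | true  = refl
  ... | false = refl

count-not : (S : Fin n → Bool) → count S + count (not ∘ S) ≡ sum {n} (λ _ → 1)
count-not S = trans (sym (∑-distrib-+ (bit ∘ S) _)) (sum-cong-≗ (λ i → bits (S i)))
  where
  bits : ∀ a → bit a + bit (not a) ≡ 1
  bits true  = refl
  bits false = refl

∧-true : ∀ {a b} → a ∧ b ≡ true → a ≡ true × b ≡ true
∧-true {true} {true} _ = refl , refl

∨-true : ∀ {a b} → a ∨ b ≡ true → a ≡ true ⊎ b ≡ true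
∨-true {true}  _ = inj₁ refl
∨-true {false} e = inj₂ e

∨-trueˡ : ∀ {a b} → a ≡ true → a ∨ b ≡ true
∨-trueˡ refl = refl

∨-trueʳ : ∀ {a b} → b ≡ true → a ∨ b ≡ true
∨-trueʳ {true}  refl = refl
∨-trueʳ {false} refl = refl

not-true : ∀ {a} → not a ≡ true → a ≡ false
not-true {false} _ = refl

false≢true : ∀ {a} → a ≡ false → a ≢ true
false≢true refl ()

-- Hall's theorem

Matching : (Fin n → Fin n → Bool) → Set
Matching {n} T = Σ (Fin n → Fin n) λ f → Injective _≡_ _≡_ f × (∀ u → T u (f u) ≡ true)

-- `cols` may exceed the set of neighbours of `rows`; unions and intersections of violators can then
-- be formed without computing neighbourhoods.
record Violator (T : Fin n → Fin n → Bool) : Set where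
  field
    rows cols : Fin n → Bool
    closed    : ∀ u v → rows u ≡ true → T u v ≡ true → cols v ≡ true
    small     : count cols < count rows

open Violator

deleteEdge : (Fin n → Fin n → Bool) → Fin n → Fin n → Fin n → Fin n → Bool
deleteEdge T u v u' v' = T u' v' ∧ not (⁅ u ⁆ u' ∧ ⁅ v ⁆ v')

module _ (T : Fin n → Fin n → Bool) where

  edges : ℕ
  edges = sum (λ u → count (T u))

  deleteEdge⁺ : ∀ u v {u' v'} → T u' v' ≡ true → u ≢ u' ⊎ v ≢ v' →
                deleteEdge T u v u' v' ≡ true
  deleteEdge⁺ u v {u'} {v'} t (inj₁ u≢) rewrite t | ≢⇒∉⁅⁆ {u = u} {u'} u≢ = refl
  deleteEdge⁺ u v {u'} {v'} t (inj₂ v≢) rewrite t | ≢⇒∉⁅⁆ {u = v} {v'} v≢ with ⁅ u ⁆ u'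
  ... | true  = refl
  ... | false = refl

  deleteEdge-< : ∀ u v → T u v ≡ true → sum (λ i → count (deleteEdge T u v i)) < edges
  deleteEdge-< u v t = sum-mono-< (λ i → sum-mono (le i)) u
    (sum-mono-< (le u) v lt)
    where
    le : ∀ i j → bit (deleteEdge T u v i j) ≤ bit (T i j)
    le i j with T i j | ⁅ u ⁆ i ∧ ⁅ v ⁆ j
    ... | true  | true  = z≤n
    ... | true  | false = ≤-refl
    ... | false | _     = z≤n
    lt : bit (deleteEdge T u v u v) < bit (T u v)
    lt rewrite t | ≡⇒∈⁅⁆ {u = u} {u} refl | ≡⇒∈⁅⁆ {u = v} {v} refl = s≤s z≤n

  matching-deleteEdge : ∀ u v → Matching (deleteEdge T u v) → Matching T
  matching-deleteEdge u v (f , inj , e) = f , inj , λ i → proj₁ (∧-true {T i (f i)} (e i))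

  violator-deleteEdge : ∀ u v (V : Violator (deleteEdge T u v)) →
                        rows V u ≡ false → Violator T
  violator-deleteEdge u v V u∉ = record
    { rows   = rows V
    ; cols   = cols V
    ; closed = λ i j i∈ t → closed V i j i∈ (deleteEdge⁺ u v t (inj₁ λ { refl → false≢true u∉ i∈ }))
    ; small  = small V }

  -- Submodularity: either the union of the two violators or their
  -- intersection without u violates Hall's condition in T itself.
  uncross : ∀ u {v v'} → v ≢ v' →
            (V : Violator (deleteEdge T u v)) (V' : Violator (deleteEdge T u v')) →
            rows V u ≡ true → rows V' u ≡ true → Violator T
  uncross u {v} {v'} v≢v' V V' u∈ u∈' = choose
    where
    S∪ S∩ S∩∖u R∪ R∩ : Fin n → Bool
    S∪ i = rows V i ∨ rows V' i
    S∩ i = rows V i ∧ rows V' i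
    S∩∖u i = S∩ i ∧ not (⁅ u ⁆ i)
    R∪ i = cols V i ∨ cols V' i
    R∩ i = cols V i ∧ cols V' i

    closed∪ : ∀ i j → S∪ i ≡ true → T i j ≡ true → R∪ j ≡ true
    closed∪ i j i∈ t with u ≟ i
    closed∪ i j i∈ t | no u≢i with ∨-true {rows V i} i∈
    ... | inj₁ i∈₁ = ∨-trueˡ (closed V i j i∈₁ (deleteEdge⁺ u v t (inj₁ u≢i)))
    ... | inj₂ i∈₂ = ∨-trueʳ (closed V' i j i∈₂ (deleteEdge⁺ u v' t (inj₁ u≢i)))
    -- Each violator ignores one edge out of `u`: the first covers all neighbours of `u` but `v`,
    -- and the second covers `v`, since its missing edge ends in `v'`.
    closed∪ i j i∈ t | yes refl with v ≟ j
    ... | no v≢j   = ∨-trueˡ (closed V i j u∈ (deleteEdge⁺ u v t (inj₂ v≢j)))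
    ... | yes refl = ∨-trueʳ (closed V' i j u∈' (deleteEdge⁺ u v' t (inj₂ (v≢v' ∘ sym))))

    closed∩ : ∀ i j → S∩∖u i ≡ true → T i j ≡ true → R∩ j ≡ true
    closed∩ i j i∈ t with ∧-true {S∩ i} i∈
    ... | i∈∩ , i∉u with ∧-true {rows V i} i∈∩
    ... | i∈₁ , i∈₂ = cong₂ _∧_ (closed V i j i∈₁ (deleteEdge⁺ u v t (inj₁ u≢i)))
                                (closed V' i j i∈₂ (deleteEdge⁺ u v' t (inj₁ u≢i)))
      where
      u≢i : u ≢ i
      u≢i u≡i = false≢true (not-true i∉u) (≡⇒∈⁅⁆ u≡i)

    -- The two strict inequalities gain two units and removing `u` from the intersection costs one,
    -- so at least one of the two candidates is small.
    counts : count R∪ + suc (count R∩) < count S∪ + suc (count S∩∖u)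
    counts = begin-strict
      count R∪ + suc (count R∩)             ≡⟨ +-suc _ _ ⟩
      suc (count R∪ + count R∩)             ≡⟨ cong suc (count-∨-∧ (cols V) (cols V')) ⟩
      suc (count (cols V) + count (cols V')) <⟨ +-mono-≤-< (small V) (small V') ⟩
      count (rows V) + count (rows V')      ≡⟨ count-∨-∧ (rows V) (rows V') ⟨
      count S∪ + count S∩                   ≡⟨ cong (count S∪ +_) (count-delete S∩ (cong₂ _∧_ u∈ u∈')) ⟨
      count S∪ + (count S∩∖u + 1)           ≡⟨ cong (count S∪ +_) (+-comm (count S∩∖u) 1) ⟩
      count S∪ + suc (count S∩∖u)           ∎
      where open ≤-Reasoning

    choose : Violator T
    choose with count R∪ <? count S∪
    ... | yes R∪<S∪ = record { rows = S∪ ; cols = R∪ ; closed = closed∪ ; small = R∪<S∪ }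
    ... | no  R∪≮S∪ = record { rows = S∩∖u ; cols = R∩ ; closed = closed∩ ; small = R∩<S∩∖u }
      where
      R∩<S∩∖u : count R∩ < count S∩∖u
      R∩<S∩∖u with count R∩ <? count S∩∖u
      ... | yes lt = lt
      ... | no  ¬lt = contradiction counts
                        (≤⇒≯ (+-mono-≤ (≮⇒≥ R∪≮S∪) (s≤s (≮⇒≥ ¬lt))))

  -- The base case, with at most one edge per row: an empty row is a violator, two rows sharing a
  -- column are a violator, and otherwise the edges form a matching.
  hall-functional : (∀ {u v v'} → T u v ≡ true → T u v' ≡ true → v ≡ v') →
                    Matching T ⊎ Violator T
  hall-functional unique with all? (λ u → any? (λ v → T u v ≟ᵇ true))
  ... | no ¬total with u , ¬e ← ¬∀⟶∃¬ n _ (λ u → any? (λ v → T u v ≟ᵇ true)) ¬total =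
    inj₂ record
      { rows = ⁅ u ⁆ ; cols = λ _ → false
      ; closed = λ i j i∈ t →
          contradiction (j , subst (λ z → T z j ≡ true) (sym (∈⁅⁆⇒≡ {u = u} {i} i∈)) t) ¬e
      ; small = subst₂ _<_ (sym (sum-replicate-zero n)) (sym (count-⁅⁆ u)) (s≤s z≤n) }
  ... | yes total with any? (λ u → any? (λ v → ¬? (u ≟ v) ×-dec (proj₁ (total u) ≟ proj₁ (total v))))
  ... | no ¬collision = inj₁ (proj₁ ∘ total , inj , proj₂ ∘ total)
    where
    inj : Injective _≡_ _≡_ (proj₁ ∘ total)
    inj {u} {v} e with u ≟ v
    ... | yes u≡v = u≡v
    ... | no  u≢v = contradiction (u , v , u≢v , e) ¬collision
  ... | yes (u , v , u≢v , e) = inj₂ record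
      { rows = λ i → ⁅ u ⁆ i ∨ ⁅ v ⁆ i
      ; cols = ⁅ proj₁ (total u) ⁆
      ; closed = cl
      ; small = subst₂ _<_ (sym (count-⁅⁆ (proj₁ (total u)))) (sym size) (s≤s (s≤s z≤n)) }
    where
    cl : ∀ i j → ⁅ u ⁆ i ∨ ⁅ v ⁆ i ≡ true → T i j ≡ true → ⁅ proj₁ (total u) ⁆ j ≡ true
    cl i j i∈ t with ∨-true {⁅ u ⁆ i} i∈
    ... | inj₁ i∈u with refl ← ∈⁅⁆⇒≡ {u = u} {i} i∈u = ≡⇒∈⁅⁆ (unique (proj₂ (total i)) t)
    ... | inj₂ i∈v with refl ← ∈⁅⁆⇒≡ {u = v} {i} i∈v = ≡⇒∈⁅⁆ (trans e (unique (proj₂ (total i)) t))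
    disjoint : ∀ i → bit (⁅ u ⁆ i ∨ ⁅ v ⁆ i) ≡ bit (⁅ u ⁆ i) + bit (⁅ v ⁆ i)
    disjoint i with u ≟ i | v ≟ i
    ... | yes refl | yes refl = contradiction refl u≢v
    ... | yes _    | no _     = refl
    ... | no _     | _        = refl
    size : count (λ i → ⁅ u ⁆ i ∨ ⁅ v ⁆ i) ≡ 2
    size = trans (sum-cong-≗ disjoint) (trans (∑-distrib-+ (bit ∘ ⁅ u ⁆) _)
             (cong₂ _+_ (count-⁅⁆ u) (count-⁅⁆ v)))

-- Rado's proof: delete edges while some row has two of them.
hall : (T : Fin n → Fin n → Bool) → Matching T ⊎ Violator T
hall T = go T (<-wellFounded (edges T))
  where
  go : (T : Fin n → Fin n → Bool) → Acc _<_ (edges T) → Matching T ⊎ Violator T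
  go T (acc rec) with any? (λ u → any? λ v → any? λ v' →
    (T u v ≟ᵇ true) ×-dec (T u v' ≟ᵇ true) ×-dec ¬? (v ≟ v'))
  ... | no ¬branch = hall-functional T functional
    where
    functional : ∀ {u v v'} → T u v ≡ true → T u v' ≡ true → v ≡ v'
    functional {u} {v} {v'} t t' with v ≟ v'
    ... | yes v≡v' = v≡v'
    ... | no  v≢v' = contradiction (u , v , v' , t , t' , v≢v') ¬branch
  ... | yes (u , v , v' , t , t' , v≢v')
    with go (deleteEdge T u v) (rec (deleteEdge-< T u v t))
       | go (deleteEdge T u v') (rec (deleteEdge-< T u v' t'))
  ... | inj₁ M | _      = inj₁ (matching-deleteEdge T u v M)
  ... | inj₂ _ | inj₁ M = inj₁ (matching-deleteEdge T u v' M)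
  ... | inj₂ V | inj₂ V' with rows V u in eq | rows V' u in eq'
  ... | false | _     = inj₂ (violator-deleteEdge T u v V eq)
  ... | true  | false = inj₂ (violator-deleteEdge T u v' V' eq')
  ... | true  | true  = inj₂ (uncross T u v≢v' V V' eq eq')

-- Egerváry's theorem

Feasible : (W : Fin n → Fin n → ℕ) (α β : Fin n → ℕ) → Set
Feasible W α β = ∀ u v → W u v ≤ α u + β v

module _ (W : Fin n → Fin n → ℕ) (α β : Fin n → ℕ) (feasible : Feasible W α β) where

  tight : Fin n → Fin n → Bool
  tight u v = does (W u v ℕ.≟ α u + β v)

  slack : ∀ {u v} → tight u v ≢ true → W u v < α u + β v
  slack {u} {v} ¬t = ≤∧≢⇒< (feasible u v) (¬t ∘ dec-true (W u v ℕ.≟ α u + β v))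

  -- Shift the potentials along a Hall violator.  The potentials are natural
  -- numbers, so when α vanishes on some row of the violator the complementary
  -- shift is used instead.
  improve : Violator tight → Σ (Fin n → ℕ) λ α' → Σ (Fin n → ℕ) λ β' →
            Feasible W α' β' × sum α' + sum β' < sum α + sum β
  improve V with any? (λ u → (rows V u ≟ᵇ true) ×-dec (α u ℕ.≟ 0))
  ... | no positive = α' , β' , feasible' , decrease
    where
    α' β' : Fin n → ℕ
    α' u = α u ∸ bit (rows V u)
    β' v = β v + bit (cols V v)
    pos : ∀ u → bit (rows V u) ≤ α u
    pos u with rows V u in eq
    ... | false = z≤n
    ... | true  = n≢0⇒n>0 (λ α≡0 → positive (u , eq , α≡0))
    feasible' : Feasible W α' β'
    feasible' u v with rows V u in eqS | cols V v in eqR | pos u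
    ... | false | r     | _ = ≤-trans (feasible u v) (+-monoʳ-≤ (α u) (m≤m+n _ _))
    ... | true  | true  | p = ≤-trans (feasible u v) (≤-reflexive (begin
      α u + β v           ≡⟨ cong (_+ β v) (m∸n+n≡m p) ⟨
      (α u ∸ 1) + 1 + β v ≡⟨ rearr (α u ∸ 1) (β v) ⟩
      (α u ∸ 1) + (β v + 1) ∎))
      where
      open ≡-Reasoning
      rearr : ∀ a b → a + 1 + b ≡ a + (b + 1)
      rearr = solve-∀
    -- Only pairs from a row of the violator to a column outside it lose a unit; by `closed` they
    -- are not tight, so a unit is available.
    ... | true  | false | p = +-cancelˡ-≤ 1 _ _ (begin
      suc (W u v)               ≤⟨ slack (false≢true eqR ∘ closed V u v eqS) ⟩
      α u + β v                 ≡⟨ cong (_+ β v) (m+[n∸m]≡n p) ⟨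
      1 + (α u ∸ 1) + β v       ≡⟨ cong (suc (α u ∸ 1) +_) (+-identityʳ (β v)) ⟨
      1 + ((α u ∸ 1) + (β v + 0)) ∎)
      where
      open ≤-Reasoning
    decrease : sum α' + sum β' < sum α + sum β
    decrease = begin-strict
      sum α' + sum β'                     ≡⟨ cong (sum α' +_) (∑-distrib-+ β _) ⟩
      sum α' + (sum β + count (cols V))   <⟨ +-monoʳ-< (sum α') (+-monoʳ-< (sum β) (small V)) ⟩
      sum α' + (sum β + count (rows V))   ≡⟨ rearr (sum α') (sum β) (count (rows V)) ⟩
      (sum α' + count (rows V)) + sum β   ≡⟨ cong (_+ sum β) (∑-distrib-+ α' _) ⟨
      sum (λ u → α' u + bit (rows V u)) + sum β
        ≡⟨ cong (_+ sum β) (sum-cong-≗ (λ u → m∸n+n≡m (pos u))) ⟩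
      sum α + sum β                       ∎
      where
      open ≤-Reasoning
      rearr : ∀ a b c → a + (b + c) ≡ (a + c) + b
      rearr = solve-∀
  ... | yes (u₀ , u₀∈ , αu₀≡0) = α' , β' , feasible' , decrease
    where
    α' β' : Fin n → ℕ
    α' u = α u + bit (not (rows V u))
    β' v = β v ∸ bit (not (cols V v))
    outside : ∀ {u v} → rows V u ≡ true → cols V v ≡ false → W u v < α u + β v
    outside {u} {v} u∈ v∉ = slack (false≢true v∉ ∘ closed V u v u∈)
    pos : ∀ v → bit (not (cols V v)) ≤ β v
    pos v with cols V v in eq
    ... | true  = z≤n
    -- The pair `(u₀ , v)` is not tight and `α u₀` is 0, so `W u₀ v < β v` and `β v` can be lowered.
    ... | false = ≤-trans (s≤s z≤n) (subst (λ a → W u₀ v < a + β v) αu₀≡0 (outside u₀∈ eq))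
    feasible' : Feasible W α' β'
    feasible' u v with rows V u in eqS | cols V v in eqR | pos v
    ... | s     | true  | _ = ≤-trans (feasible u v) (+-monoˡ-≤ (β v) (m≤m+n _ _))
    ... | false | false | p = ≤-trans (feasible u v) (≤-reflexive (begin
      α u + β v             ≡⟨ cong (α u +_) (m+[n∸m]≡n p) ⟨
      α u + (1 + (β v ∸ 1)) ≡⟨ +-assoc (α u) 1 _ ⟨
      (α u + 1) + (β v ∸ 1) ∎))
      where open ≡-Reasoning
    ... | true  | false | p = +-cancelˡ-≤ 1 _ _ (begin
      suc (W u v)               ≤⟨ outside eqS eqR ⟩
      α u + β v                 ≡⟨ cong (α u +_) (m+[n∸m]≡n p) ⟨
      α u + (1 + (β v ∸ 1))     ≡⟨ rearr (α u) (β v ∸ 1) ⟩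
      1 + ((α u + 0) + (β v ∸ 1)) ∎)
      where
      open ≤-Reasoning
      rearr : ∀ a b → a + (1 + b) ≡ 1 + ((a + 0) + b)
      rearr = solve-∀
    -- Complements reverse the inequality, so fewer potentials are raised than lowered.
    complement : count (not ∘ rows V) < count (not ∘ cols V)
    complement = +-cancelˡ-< (count (cols V)) _ _ (begin-strict
      count (cols V) + count (not ∘ rows V) <⟨ +-monoˡ-< (count (not ∘ rows V)) (small V) ⟩
      count (rows V) + count (not ∘ rows V) ≡⟨ count-not (rows V) ⟩
      sum {n} (λ _ → 1)                     ≡⟨ count-not (cols V) ⟨
      count (cols V) + count (not ∘ cols V) ∎)
      where open ≤-Reasoning
    decrease : sum α' + sum β' < sum α + sum β
    decrease = begin-strict
      sum α' + sum β'                           ≡⟨ cong (_+ sum β') (∑-distrib-+ α _) ⟩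
      sum α + count (not ∘ rows V) + sum β'     <⟨ +-monoˡ-< (sum β') (+-monoʳ-< (sum α) complement) ⟩
      sum α + count (not ∘ cols V) + sum β'     ≡⟨ rearr (sum α) (count (not ∘ cols V)) (sum β') ⟩
      sum α + (sum β' + count (not ∘ cols V))   ≡⟨ cong (sum α +_) (∑-distrib-+ β' _) ⟨
      sum α + sum (λ v → β' v + bit (not (cols V v)))
        ≡⟨ cong (sum α +_) (sum-cong-≗ (λ v → m∸n+n≡m (pos v))) ⟩
      sum α + sum β                             ∎
      where
      open ≤-Reasoning
      rearr : ∀ a b c → a + b + c ≡ a + (c + b)
      rearr = solve-∀

-- An optimal assignment with its certificate: `feasible` bounds the weight of every permutation by
-- the sum of all potentials, and `assign` attains this bound.
record TightDual (W : Fin n → Fin n → ℕ) : Set where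
  field
    α β           : Fin n → ℕ
    feasible      : Feasible W α β
    assign        : Fin n → Fin n
    assign-injective : Injective _≡_ _≡_ assign
    assign-tight  : ∀ u → W u (assign u) ≡ α u + β (assign u)

-- Descent on the sum of the potentials: a violator among the tight pairs lowers it, and a perfect
-- matching of tight pairs ends the search.
egerváry : (W : Fin n → Fin n → ℕ) (α β : Fin n → ℕ) → Feasible W α β → TightDual W
egerváry W α β feasible = go α β feasible (<-wellFounded _)
  where
  go : ∀ α β → Feasible W α β → Acc _<_ (sum α + sum β) → TightDual W
  go α β feasible (acc rec) with hall (tight W α β feasible)
  ... | inj₁ (f , inj , t) = record
    { α = α ; β = β ; feasible = feasible ; assign = f ; assign-injective = inj
    ; assign-tight = λ u → does⇒ (W u (f u) ℕ.≟ α u + β (f u)) (t u) }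
  ... | inj₂ V with α' , β' , feasible' , lt ← improve W α β feasible V =
    go α' β' feasible' (rec lt)

-- Permutations and the numbering of disjoint unions.

-- A missed value `j` could be punched out, leaving an injection of `suc n` points into `n`.
injective⇒permutation : (f : Fin n → Fin n) → Injective _≡_ _≡_ f →
                        Σ (Permutation′ n) λ π → ∀ i → π ⟨$⟩ʳ i ≡ f i
injective⇒permutation {zero}  f inj = permutation f f (λ ()) (λ ()) , λ ()
injective⇒permutation {suc n} f inj =
  permutation f (proj₁ ∘ onto) (proj₂ ∘ onto) (λ i → inj (proj₂ (onto (f i)))) , λ _ → refl
  where
  onto : ∀ j → ∃ λ i → f i ≡ j
  onto j with any? (λ i → f i ≟ j)
  ... | yes hit = hit
  ... | no miss = contradiction (injective⇒≤ out-injective) 1+n≰n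
    where
    out : Fin (suc n) → Fin n
    out i = punchOut {i = j} {f i} (λ e → miss (i , sym e))
    out-injective : Injective _≡_ _≡_ out
    out-injective {i} {i'} e =
      inj (punchOut-injective (λ e → miss (i , sym e)) (λ e → miss (i' , sym e)) e)

-- Numbers a disjoint union of finite sets; this indexes both the pairs of the cut and the starts of
-- the walks.
encode : (c : Fin n → ℕ) → Σ (Fin n) (Fin ∘ c) → Fin (sum c)
encode c (zero  , j) = j ↑ˡ _
encode c (suc v , j) = c zero ↑ʳ encode (c ∘ suc) (v , j)

decode : (c : Fin n → ℕ) → Fin (sum c) → Σ (Fin n) (Fin ∘ c)
decode {suc n} c i = [ zero ,_ , (λ k → Product.map suc id (decode (c ∘ suc) k)) ]′ (splitAt (c zero) i)

decode-encode : (c : Fin n → ℕ) (x : Σ (Fin n) (Fin ∘ c)) → decode c (encode c x) ≡ x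
decode-encode c (zero , j) rewrite splitAt-↑ˡ (c zero) j (sum (c ∘ suc)) = refl
decode-encode c (suc v , j)
  rewrite splitAt-↑ʳ (c zero) (sum (c ∘ suc)) (encode (c ∘ suc) (v , j))
        | decode-encode (c ∘ suc) (v , j) = refl

encode-decode : (c : Fin n → ℕ) (i : Fin (sum c)) → encode c (decode c i) ≡ i
encode-decode {suc n} c i with splitAt (c zero) i | join-splitAt (c zero) (sum (c ∘ suc)) i
... | inj₁ j | e = e
... | inj₂ k | e = trans (cong (c zero ↑ʳ_) (encode-decode (c ∘ suc) k)) e

-- Image sizes

concatMap-map : {A B C : Set} (f : A → B → C) (xs : List A) (ys : List B) →
                concatMap (λ x → List.map (f x) ys) xs ≡ cartesianProductWith f xs ys
concatMap-map f []       ys = refl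
concatMap-map f (x ∷ xs) ys = cong (List.map (f x) ys List.++_) (concatMap-map f xs ys)

allConfigs-suc : ∀ q n → allConfigs q (suc n) ≡ cartesianProductWith _∷_ (allFin q) (allConfigs q n)
allConfigs-suc q n = concatMap-map _∷_ (allFin q) (allConfigs q n)

∈-allConfigs : (x : Config q n) → x ∈ allConfigs q n
∈-allConfigs []                      = here refl
∈-allConfigs {q} {suc n} (a ∷ x) rewrite allConfigs-suc q n =
  ∈-cartesianProductWith⁺ _∷_ (∈-allFin a) (∈-allConfigs x)

allConfigs-unique : ∀ q n → Unique (allConfigs q n)
allConfigs-unique q zero    = All.[] ∷ []
allConfigs-unique q (suc n) rewrite allConfigs-suc q n =
  cartesianProductWith⁺ _∷_ ∷-injective (allFin⁺ q) (allConfigs-unique q n)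

lookup-injective : {A : Set} {xs : List A} → Unique xs → Injective _≡_ _≡_ (List.lookup xs)
lookup-injective (x∉ ∷ u) {zero}  {zero}  e = refl
lookup-injective (x∉ ∷ u) {zero}  {suc j} e = contradiction e (All.lookup x∉ (∈-lookup j))
lookup-injective (x∉ ∷ u) {suc i} {zero}  e = contradiction (sym e) (All.lookup x∉ (∈-lookup i))
lookup-injective (x∉ ∷ u) {suc i} {suc j} e = cong suc (lookup-injective u e)

module _ (g : Map q n) where

  inImage? : (y : Config q n) → Dec (Any.Any (λ x → g x ≡ y) (allConfigs q n))
  inImage? y = Any.any? (λ x → ≡-dec _≟_ (g x) y) (allConfigs q n)

  image : List (Config q n)
  image = filter inImage? (allConfigs q n)

  ∈-image : ∀ x → g x ∈ image
  ∈-image x = ∈-filter⁺ inImage? (∈-allConfigs (g x))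
    (Any.map (λ { refl → refl }) (∈-allConfigs x))

  -- With a preimage chosen for each image point, distinct image points have distinct codes, and
  -- there are `q ^ m` codes.
  imageSize-≤ : (code : Config q n → Fin m → Fin q) →
                (∀ x y → code x ≗ code y → g x ≡ g y) → imageSize g ≤ q ^ m
  imageSize-≤ {m} code determines = injective⇒≤ {f = funToFin ∘ code ∘ proj₁ ∘ preimage} inj
    where
    preimage : ∀ i → ∃ λ x → g x ≡ List.lookup image i
    preimage i = Any.satisfied (proj₂ (∈-filter⁻ inImage? {xs = allConfigs q n} (∈-lookup {xs = image} i)))
    inj : Injective _≡_ _≡_ (funToFin ∘ code ∘ proj₁ ∘ preimage)
    inj {i} {j} e = lookup-injective (filter⁺ inImage? (allConfigs-unique q n)) (begin
      List.lookup image i            ≡⟨ proj₂ (preimage i) ⟨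
      g (proj₁ (preimage i))    ≡⟨ determines _ _ codes ⟩
      g (proj₁ (preimage j))    ≡⟨ proj₂ (preimage j) ⟩
      List.lookup image j            ∎)
      where
      open ≡-Reasoning
      codes : code (proj₁ (preimage i)) ≗ code (proj₁ (preimage j))
      codes l = trans (sym (finToFun-funToFin (code (proj₁ (preimage i))) l))
        (trans (cong (λ k → finToFun k l) e) (finToFun-funToFin (code (proj₁ (preimage j))) l))

  -- Sending a word `a` to a position of `g (e a)` in the list `image` is injective on the `q ^ m`
  -- words.
  imageSize-≥ : (e : (Fin m → Fin q) → Config q n) →
                (∀ a b → g (e a) ≡ g (e b) → a ≗ b) → q ^ m ≤ imageSize g
  imageSize-≥ {m} e determined = injective⇒≤ {f = position} inj
    where
    position : Fin (q ^ m) → Fin (length image)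
    position k = index (∈-image (e (finToFun k)))
    funToFin-cong : ∀ {m} {a b : Fin m → Fin q} → a ≗ b → funToFin a ≡ funToFin b
    funToFin-cong {zero}  _   = refl
    funToFin-cong {suc m} a≗b = cong₂ combine (a≗b zero) (funToFin-cong (a≗b ∘ suc))
    inj : Injective _≡_ _≡_ position
    inj {k} {l} eq = begin
      k                     ≡⟨ funToFin-finToFin {m} k ⟨
      funToFin (finToFun {q} {m} k) ≡⟨ funToFin-cong (determined _ _ (index-injective (setoid _)
                                 (∈-image (e (finToFun k))) (∈-image (e (finToFun l))) eq)) ⟩
      funToFin (finToFun {q} {m} l) ≡⟨ funToFin-finToFin {m} l ⟩
      l                     ∎
      where open ≡-Reasoning

-- Dependence on in-neighbours.

-- Change x into y one coordinate at a time.
update-invariant : {A B : Set} (g : Vec A n → B) (x y : Vec A n) →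
  (∀ u → (∀ z a → g z ≡ g (z [ u ]≔ a)) ⊎ lookup x u ≡ lookup y u) → g x ≡ g y
update-invariant g []      []      h = refl
update-invariant g (a ∷ x) (b ∷ y) h = trans first
  (update-invariant (g ∘ (b ∷_)) x y rest)
  where
  first : g (a ∷ x) ≡ g (b ∷ x)
  first with h zero
  ... | inj₁ const = const (a ∷ x) b
  ... | inj₂ refl  = refl
  rest : ∀ u → (∀ z c → g (b ∷ z) ≡ g (b ∷ (z [ u ]≔ c))) ⊎ lookup x u ≡ lookup y u
  rest u with h (suc u)
  ... | inj₁ const = inj₁ (λ z → const (b ∷ z))
  ... | inj₂ e     = inj₂ e

-- Coordinates without an arc to `v` can be changed one at a time without effect on `v`; at the
-- others `x` and `y` already agree.
agree-on-in-neighbours : {D : Digraph n} (f : Map q n) → IGSub f D → ∀ {x y} v →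
  (∀ u → Arc D u v → lookup x u ≡ lookup y u) →
  lookup (f x) v ≡ lookup (f y) v
agree-on-in-neighbours {D = D} f sub {x} {y} v agree =
  update-invariant (λ z → lookup (f z) v) x y coordinate
  where
  coordinate : ∀ u → _ ⊎ lookup x u ≡ lookup y u
  coordinate u with D u v in arc
  ... | true  = inj₂ (agree u arc)
  ... | false = inj₁ constant
    where
    constant : ∀ z a → lookup (f z) v ≡ lookup (f (z [ u ]≔ a)) v
    constant z a with lookup (f z) v ≟ lookup (f (z [ u ]≔ a)) v
    ... | yes e = e
    ... | no ne = contradiction (sub u v (z , a , ne)) (false≢true arc)

-- Time windows lo v ≤ s ≤ hi v closed under arcs: they cut all p-walks

module Cut (D : Digraph n) (p : ℕ) (lo hi : Fin n → ℕ) (lo≤p : ∀ v → lo v ≤ p)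
           (lo≤hi : ∀ u v → Arc D u v → lo u ≤ hi v) where

  -- Truncated subtraction makes the window empty when `hi v < lo v`.
  width : Fin n → ℕ
  width v = suc (hi v) ∸ lo v

  time : Σ (Fin n) (Fin ∘ width) → ℕ
  time (v , j) = lo v + toℕ j

  slot : ∀ v s → lo v ≤ s → s ≤ hi v → Fin (width v)
  slot v s lo≤s s≤hi = fromℕ< (∸-monoˡ-< (s≤s s≤hi) lo≤s)

  time-slot : ∀ v s lo≤s s≤hi → time (v , slot v s lo≤s s≤hi) ≡ s
  time-slot v s lo≤s s≤hi = trans (cong (lo v +_) (toℕ-fromℕ< (∸-monoˡ-< (s≤s s≤hi) lo≤s)))
    (m+[n∸m]≡n lo≤s)

  module _ (f : Map q n) (sub : IGSub f D) where

    trace : Config q n → Fin (sum width) → Fin q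
    trace x i = lookup (iter f (time (decode width i)) x) (proj₁ (decode width i))

    trace-slot : ∀ x v s lo≤s s≤hi →
                 trace x (encode width (v , slot v s lo≤s s≤hi)) ≡ lookup (iter f s x) v
    trace-slot x v s lo≤s s≤hi
      rewrite decode-encode width (v , slot v s lo≤s s≤hi) | time-slot v s lo≤s s≤hi = refl

    -- Induction on `s`. Inside its window a state is recorded; after the window has closed it is
    -- computed from in-neighbours `u` whose windows were open by the previous time, because
    -- `lo u ≤ hi v`.
    trace-determines : ∀ x y → trace x ≗ trace y → ∀ s v → lo v ≤ s →
                       lookup (iter f s x) v ≡ lookup (iter f s y) v
    trace-determines x y same s v lo≤s with s ≤? hi v
    ... | yes s≤hi = trans (sym (trace-slot x v s lo≤s s≤hi))
                       (trans (same _) (trace-slot y v s lo≤s s≤hi))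
    trace-determines x y same zero    v lo≤s | no s≰hi = contradiction z≤n s≰hi
    trace-determines x y same (suc s) v lo≤s | no s≰hi =
      agree-on-in-neighbours f sub v (λ u arc → trace-determines x y same s u
        (≤-trans (lo≤hi u v arc) (≤-pred (≰⇒> s≰hi))))

    imageSize-≤-cut : imageSize (iter f p) ≤ q ^ sum width
    imageSize-≤-cut = imageSize-≤ (iter f p) trace
      (λ x y same → Pointwise-≡⇒≡ (ext (λ v → trace-determines x y same p v (lo≤p v))))

  -- A walk cannot jump from before a window to after one: if `s < lo (w s)`, then
  -- `s + 1 ≤ lo (w s) ≤ hi (w (s + 1))`. At time `p` it is no longer too early anywhere.
  walk-hits : (w : Fin (suc p) → Fin n) → IsWalk D p w →
              ∃ λ s → lo (w s) ≤ toℕ s × toℕ s ≤ hi (w s)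
  walk-hits w walk with <-weakInduction HitOrEarly start next (fromℕ p)
    where
    HitOrEarly : Fin (suc p) → Set
    HitOrEarly s = (∃ λ s → lo (w s) ≤ toℕ s × toℕ s ≤ hi (w s)) ⊎ toℕ s < lo (w s)
    start : HitOrEarly zero
    start with lo (w zero) ≤? 0
    ... | yes lo≤0 = inj₁ (zero , lo≤0 , z≤n)
    ... | no  lo≰0 = inj₂ (≰⇒> lo≰0)
    next : ∀ s → HitOrEarly (inject₁ s) → HitOrEarly (suc s)
    next s (inj₁ hit) = inj₁ hit
    next s (inj₂ s<lo) with lo (w (suc s)) ≤? suc (toℕ s)
    ... | yes lo≤s = inj₁ (suc s , lo≤s , ≤-trans (subst (_< lo (w (inject₁ s))) (toℕ-inject₁ s) s<lo)
                                             (lo≤hi _ _ (walk s)))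
    ... | no  lo≰s = inj₂ (≰⇒> lo≰s)
  ... | inj₁ hit  = hit
  ... | inj₂ p<lo = contradiction (lo≤p (w (fromℕ p)))
                      (<⇒≱ (subst (_< lo (w (fromℕ p))) (toℕ-fromℕ p) p<lo))

  -- Two walks that hit the cut in the same pair are at the same vertex at the same time, so
  -- independent walks hit it in distinct pairs.
  independent-≤-cut : ∀ {k} → IndepWalks D p k → k ≤ sum width
  independent-≤-cut {k} (W , walks , independent) = injective⇒≤ {f = encode width ∘ point} inj
    where
    hit : ∀ i → ∃ λ s → lo (W i s) ≤ toℕ s × toℕ s ≤ hi (W i s)
    hit i = walk-hits (W i) (walks i)
    point : Fin k → Σ (Fin n) (Fin ∘ width)
    point i with s , lo≤s , s≤hi ← hit i = W i s , slot (W i s) (toℕ s) lo≤s s≤hi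
    time-point : ∀ i → time (point i) ≡ toℕ (proj₁ (hit i))
    time-point i with s , lo≤s , s≤hi ← hit i = time-slot (W i s) (toℕ s) lo≤s s≤hi
    vertex-point : ∀ i → proj₁ (point i) ≡ W i (proj₁ (hit i))
    vertex-point i with s , lo≤s , s≤hi ← hit i = refl
    inj : Injective _≡_ _≡_ (encode width ∘ point)
    inj {i} {j} e with i ≟ j
    ... | yes i≡j = i≡j
    ... | no  i≢j = contradiction collision (independent i j i≢j (proj₁ (hit i)))
      where
      points : point i ≡ point j
      points = trans (sym (decode-encode width (point i)))
                 (trans (cong (decode width) e) (decode-encode width (point j)))
      times : proj₁ (hit j) ≡ proj₁ (hit i)
      times = toℕ-injective (trans (sym (time-point j))
                (trans (cong time (sym points)) (time-point i)))
      collision : W i (proj₁ (hit i)) ≡ W j (proj₁ (hit i))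
      collision = trans (sym (vertex-point i)) (trans (cong proj₁ points)
                    (trans (vertex-point j) (cong (W j) times)))

-- Walks along the orbits of a permutation.

module Orbits (D : Digraph n) (π : Permutation′ n) where

  next : Fin n → Fin n
  next u = π ⟨$⟩ʳ u

  next-injective : Injective _≡_ _≡_ next
  next-injective e = trans (sym (inverseˡ π)) (trans (cong (π ⟨$⟩ˡ_) e) (inverseˡ π))

  orbit : ℕ → Fin n → Fin n
  orbit zero    u = u
  orbit (suc s) u = orbit s (next u)

  orbit-injective : ∀ s → Injective _≡_ _≡_ (orbit s)
  orbit-injective zero    e = e
  orbit-injective (suc s) e = next-injective (orbit-injective s e)

  good : ℕ → Fin n → Bool
  good zero    u = true
  good (suc s) u = D u (next u) ∧ good s (next u)

  good-arc : ∀ {p} u → good p u ≡ true → ∀ {s} → s < p → Arc D (orbit s u) (orbit (suc s) u)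
  good-arc {suc p} u g {zero}  _         = proj₁ (∧-true {D u (next u)} g)
  good-arc {suc p} u g {suc s} (s≤s s<p) = good-arc (next u) (proj₂ (∧-true {D u (next u)} g)) s<p

  -- Sets with at most one element, so that `encode` numbers the good starting vertices.
  size : ℕ → Fin n → ℕ
  size p = bit ∘ good p

  inhabited-bit : ∀ {b} → Fin (bit b) → b ≡ true
  inhabited-bit {true} _ = refl

  bit-irrelevant : ∀ {b} (i j : Fin (bit b)) → i ≡ j
  bit-irrelevant {true} zero zero = refl

  -- Every iterate of `π` is injective, so orbits with distinct starts never meet at the same time.
  good-walks : ∀ p → IndepWalks D p (sum (size p))
  good-walks p = (λ i s → orbit (toℕ s) (start i)) , walk , independent
    where
    start : Fin (sum (size p)) → Fin n
    start i = proj₁ (decode (size p) i)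
    walk : ∀ i → IsWalk D p (λ s → orbit (toℕ s) (start i))
    walk i s = subst (λ t → Arc D (orbit t (start i)) (orbit (suc (toℕ s)) (start i)))
      (sym (toℕ-inject₁ s))
      (good-arc (start i) (inhabited-bit (proj₂ (decode (size p) i))) (toℕ<n s))
    Σ-bit-≡ : (x y : Σ (Fin n) (Fin ∘ size p)) → proj₁ x ≡ proj₁ y → x ≡ y
    Σ-bit-≡ (u , i) (.u , j) refl = cong (u ,_) (bit-irrelevant i j)
    independent : ∀ i j → i ≢ j → Independent {p = p} _ _
    independent i j i≢j s e = i≢j (trans (sym (encode-decode (size p) i))
      (trans (cong (encode (size p)) (Σ-bit-≡ _ _ (orbit-injective (toℕ s) e)))
             (encode-decode (size p) j)))

  -- A non-arc u → next u spoils at most s orbits of length s, and only the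
  -- orbit of u itself when next u = u.
  loss : ℕ → Fin n → ℕ
  loss zero    u = 0
  loss (suc s) u = if D u (next u) then 0 else if ⁅ u ⁆ (next u) then 1 else suc s

  bad : ℕ → Fin n → ℕ
  bad s u = bit (not (good s u))

  -- Induction on `s`: the growth of `loss` at `u` pays for the excess of `bad (suc s) u` over
  -- `bad s (next u)`, and summing over all `u` removes the shift by `next`.
  bad-≤-loss : ∀ s → sum (bad s) ≤ sum (loss s)
  bad-≤-loss zero    = ≤-refl
  bad-≤-loss (suc s) = +-cancelʳ-≤ (sum (loss s)) _ _ (begin
    sum (bad (suc s)) + sum (loss s)             ≡⟨ ∑-distrib-+ (bad (suc s)) (loss s) ⟨
    sum (λ u → bad (suc s) u + loss s u)         ≤⟨ sum-mono (pointwise s) ⟩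
    sum (λ u → loss (suc s) u + bad s (next u))  ≡⟨ ∑-distrib-+ (loss (suc s)) (bad s ∘ next) ⟩
    sum (loss (suc s)) + sum (bad s ∘ next)      ≡⟨ cong (sum (loss (suc s)) +_) (sum-permute (bad s) π) ⟨
    sum (loss (suc s)) + sum (bad s)             ≤⟨ +-monoʳ-≤ (sum (loss (suc s))) (bad-≤-loss s) ⟩
    sum (loss (suc s)) + sum (loss s)            ∎)
    where
    open ≤-Reasoning
    pointwise : ∀ s u → bad (suc s) u + loss s u ≤ loss (suc s) u + bad s (next u)
    pointwise zero u with D u (next u) | u ≟ next u
    ... | true  | _     = z≤n
    ... | false | yes _ = s≤s z≤n
    ... | false | no _  = s≤s z≤n
    pointwise (suc s) u with D u (next u) in arc | u ≟ next u
    ... | true  | _        = ≤-reflexive (+-identityʳ _)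
    ... | false | no _     = s≤s (m≤m+n _ _)
    -- A missing loop is charged only once: the loss does not grow, but the orbit of `next u = u`
    -- was already bad at the previous length.
    ... | false | yes fixed = s≤s (≤-reflexive (sym still-bad))
      where
      still-bad : bad (suc s) (next u) ≡ 1
      still-bad = subst (λ v → bad (suc s) v ≡ 1) fixed (cong (λ a → bit (not (a ∧ good s (next u)))) arc)

  good+bad : ∀ s u → size s u + bad s u ≡ 1
  good+bad s u with good s u
  ... | true  = refl
  ... | false = refl

-- Duality between walks and cuts.

-- Maximising the total weight of a permutation u ↦ π u packs D with paths and
-- cycles: a non-arc u → π u with π u ≠ u ends a path, which costs p.
module Duality (D : Digraph n) (p' : ℕ) where

  p : ℕ
  p = suc p'

  weight : Fin n → Fin n → ℕ
  weight u v = if D u v then p else if ⁅ u ⁆ v then p' else 0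

  weight-≤ : ∀ u v → weight u v ≤ p
  weight-≤ u v with D u v | ⁅ u ⁆ v
  ... | true  | _     = ≤-refl
  ... | false | true  = n≤1+n p'
  ... | false | false = z≤n

  weight-arc : ∀ {u v} → Arc D u v → weight u v ≡ p
  weight-arc arc rewrite arc = refl

  -- This is the purpose of the weight `p'`: it gives `p ≤ suc (α v + β v)`, hence
  -- `lo v ≤ suc (hi v)`, so the subtraction in `width` is exact.
  weight-diagonal : ∀ v → p' ≤ weight v v
  weight-diagonal v rewrite ≡⇒∈⁅⁆ {u = v} {v} refl with D v v
  ... | true  = n≤1+n p'
  ... | false = ≤-refl

  open TightDual (egerváry weight (λ _ → p) (λ _ → 0)
    (λ u v → ≤-trans (weight-≤ u v) (m≤m+n p 0))) public

  π : Permutation′ n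
  π = proj₁ (injective⇒permutation assign assign-injective)

  π≗assign : ∀ u → π ⟨$⟩ʳ u ≡ assign u
  π≗assign = proj₂ (injective⇒permutation assign assign-injective)

  open Orbits D π public

  -- On an arc feasibility reads `p ≤ α u + β v`, which is the closure condition `p ∸ α u ≤ β v` of
  -- a cut.
  open Cut D p (λ v → p ∸ α v) β (λ v → m∸n≤m p (α v))
    (λ u v arc → m≤n+o⇒m∸n≤o p (α u) (subst (_≤ α u + β v) (weight-arc arc) (feasible u v))) public

  width-≤ : ∀ v → width v + p ≤ suc (α v) + β v
  width-≤ v = begin
    -- An inequality only, since `α v` may exceed `p`.
    width v + p                     ≤⟨ +-monoʳ-≤ (width v) (m≤n+m∸n p (α v)) ⟩
    width v + (α v + (p ∸ α v))     ≡⟨ rearr (width v) (α v) (p ∸ α v) ⟩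
    α v + (width v + (p ∸ α v))     ≡⟨ cong (α v +_) (m∸n+n≡m lo≤1+hi) ⟩
    α v + suc (β v)                 ≡⟨ +-suc (α v) (β v) ⟩
    suc (α v) + β v                 ∎
    where
    open ≤-Reasoning
    rearr : ∀ a b c → a + (b + c) ≡ b + (a + c)
    rearr = solve-∀
    lo≤1+hi : p ∸ α v ≤ suc (β v)
    lo≤1+hi = m≤n+o⇒m∸n≤o p (α v) (begin
      suc p'            ≤⟨ s≤s (≤-trans (weight-diagonal v) (feasible v v)) ⟩
      suc (α v + β v)   ≡⟨ +-suc (α v) (β v) ⟨
      α v + suc (β v)   ∎)

  -- The loss of a step is exactly `p` minus its weight, so maximising weight minimises loss.
  weight+loss : ∀ u → suc (weight u (next u)) + loss p u ≡ suc p
  weight+loss u with D u (next u) | ⁅ u ⁆ (next u)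
  ... | true  | _     = cong suc (+-identityʳ p)
  ... | false | true  = cong suc (+-comm p' 1)
  ... | false | false = refl

  -- Reindexing the sum of `β` by `π` pairs `α u` with `β (next u)`, where the potentials are tight.
  dual-sum : sum (λ v → suc (α v) + β v) ≡ sum (λ u → suc (weight u (next u)))
  dual-sum = begin
    sum (λ v → suc (α v) + β v)         ≡⟨ ∑-distrib-+ (suc ∘ α) β ⟩
    sum (suc ∘ α) + sum β               ≡⟨ cong (sum (suc ∘ α) +_) (sum-permute β π) ⟩
    sum (suc ∘ α) + sum (β ∘ next)      ≡⟨ ∑-distrib-+ (suc ∘ α) (β ∘ next) ⟨
    sum (λ u → suc (α u) + β (next u))  ≡⟨ sum-cong-≗ (λ u → cong suc (sym (tight-next u))) ⟩
    sum (λ u → suc (weight u (next u))) ∎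
    where
    open ≡-Reasoning
    tight-next : ∀ u → weight u (next u) ≡ α u + β (next u)
    tight-next u rewrite π≗assign u = assign-tight u

  -- The widths plus `P` are bounded by the potentials, which equal the weights; weight and loss of
  -- a step add up to `p`, and the loss bounds the number of bad orbits. `P` and the loss stay on
  -- both sides to avoid subtraction.
  cut-≤-good : sum width ≤ sum (size p)
  cut-≤-good = +-cancelʳ-≤ (P + sum (loss p)) _ _ (begin
    sum width + (P + sum (loss p))              ≡⟨ +-assoc (sum width) P _ ⟨
    (sum width + P) + sum (loss p)              ≡⟨ cong (_+ sum (loss p)) (∑-distrib-+ width _) ⟨
    sum (λ v → width v + p) + sum (loss p)      ≤⟨ +-monoˡ-≤ (sum (loss p)) (sum-mono width-≤) ⟩
    sum (λ v → suc (α v) + β v) + sum (loss p)  ≡⟨ cong (_+ sum (loss p)) dual-sum ⟩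
    sum (λ u → suc (weight u (next u))) + sum (loss p)
      ≡⟨ ∑-distrib-+ (λ u → suc (weight u (next u))) (loss p) ⟨
    sum (λ u → suc (weight u (next u)) + loss p u) ≡⟨ sum-cong-≗ weight+loss ⟩
    sum {n} (λ _ → 1 + p)                       ≡⟨ ∑-distrib-+ {n} (λ _ → 1) (λ _ → p) ⟩
    sum {n} (λ _ → 1) + P                       ≡⟨ cong (_+ P) (sum-cong-≗ (good+bad p)) ⟨
    sum (λ u → size p u + bad p u) + P          ≡⟨ cong (_+ P) (∑-distrib-+ (size p) (bad p)) ⟩
    (sum (size p) + sum (bad p)) + P            ≡⟨ rearr (sum (size p)) (sum (bad p)) P ⟩
    sum (size p) + (P + sum (bad p))            ≤⟨ +-monoʳ-≤ (sum (size p)) (+-monoʳ-≤ P (bad-≤-loss p)) ⟩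
    sum (size p) + (P + sum (loss p))           ∎)
    where
    open ≤-Reasoning
    P : ℕ
    P = sum {n} (λ _ → p)
    rearr : ∀ a b c → (a + b) + c ≡ a + (c + b)
    rearr = solve-∀

  module _ {k : ℕ} (alpha : IsAlpha D p k) where

    -- There are at most `k` good walks, `k` is at most the size of the cut, and `cut-≤-good` closes
    -- the circle.
    good≡α : sum (size p) ≡ k
    good≡α = ≤-antisym (proj₂ alpha _ (good-walks p))
      (≤-trans (independent-≤-cut (proj₁ alpha)) cut-≤-good)

    cut≡α : sum width ≡ k
    cut≡α = ≤-antisym (≤-trans cut-≤-good (proj₂ alpha _ (good-walks p)))
      (independent-≤-cut (proj₁ alpha))

-- Maps attaining the bound.

isZero : ∀ {q} → Fin q → Bool
isZero zero    = true
isZero (suc _) = false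

-- Each vertex v copies its predecessor π⁻¹ v (or 1 if there is no such arc),
-- twisted by σ when all other in-neighbours vanish.  Since σ preserves the set
-- of zeros, the zeros of a trajectory depend only on the zeros of its start,
-- and so does the set of twists applied along it.
module Twisted (D : Digraph n) (π : Permutation′ n) (r : ℕ)
               (σ : Fin (suc (suc r)) → Fin (suc (suc r)))
               (σ-injective : Injective _≡_ _≡_ σ)
               (isZero-σ : ∀ a → isZero (σ a) ≡ isZero a) where

  open Orbits D π

  q′ : ℕ
  q′ = suc (suc r)

  one : Fin q′
  one = suc zero

  pre : Fin n → Fin n
  pre v = π ⟨$⟩ˡ v

  zeros : Config q′ n → Fin n → Bool
  zeros x u = isZero (lookup x u)

  Quiet : Fin n → (Fin n → Bool) → Set
  Quiet v z = ∀ u → Arc D u v → u ≢ pre v → z u ≡ true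

  quiet? : ∀ v z → Dec (Quiet v z)
  quiet? v z = all? (λ u → (D u v ≟ᵇ true) →-dec ¬? (u ≟ pre v) →-dec (z u ≟ᵇ true))

  quiet : Fin n → Config q′ n → Bool
  quiet v x = does (quiet? v (zeros x))

  quiet-cong : ∀ v x y → (∀ u → Arc D u v → u ≢ pre v → zeros x u ≡ zeros y u) →
               quiet v x ≡ quiet v y
  quiet-cong v x y same = does-⇔
    (mk⇔ (λ Q u arc u≢ → trans (sym (same u arc u≢)) (Q u arc u≢))
         (λ Q u arc u≢ → trans (same u arc u≢) (Q u arc u≢)))
    (quiet? v (zeros x)) (quiet? v (zeros y))

  twist : Bool → Fin q′ → Fin q′
  twist b = if b then σ else id

  twist-injective : ∀ b → Injective _≡_ _≡_ (twist b)
  twist-injective true  = σ-injective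
  twist-injective false = id

  isZero-twist : ∀ b a → isZero (twist b a) ≡ isZero a
  isZero-twist true  = isZero-σ
  isZero-twist false _ = refl

  base : Fin n → Config q′ n → Fin q′
  base v x = if D (pre v) v then lookup x (pre v) else one

  F : Map q′ n
  F x = tabulate (λ v → twist (quiet v x) (base v x))

  lookup-F : ∀ x v → lookup (F x) v ≡ twist (quiet v x) (base v x)
  lookup-F x v = lookup∘tabulate _ v

  zeros-F : ∀ x v → zeros (F x) v ≡ isZero (base v x)
  zeros-F x v = trans (cong isZero (lookup-F x v)) (isZero-twist (quiet v x) (base v x))

  base-next : ∀ x u → Arc D u (next u) → base (next u) x ≡ lookup x u
  base-next x u arc rewrite inverseˡ π {u} | arc = refl

  ~-F : ∀ {x y} → zeros x ≗ zeros y → zeros (F x) ≗ zeros (F y)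
  ~-F {x} {y} x~y v = trans (zeros-F x v) (trans isZero-base (sym (zeros-F y v)))
    where
    isZero-base : isZero (base v x) ≡ isZero (base v y)
    isZero-base with D (pre v) v
    ... | true  = x~y (pre v)
    ... | false = refl

  -- Equal zeros give equal quietness, so both values carry the same injective twist, which cancels.
  F-reflects : ∀ {x y} → zeros x ≗ zeros y → ∀ u → Arc D u (next u) →
               lookup (F x) (next u) ≡ lookup (F y) (next u) → lookup x u ≡ lookup y u
  F-reflects {x} {y} x~y u arc e = begin
    lookup x u        ≡⟨ base-next x u arc ⟨
    base (next u) x   ≡⟨ twist-injective (quiet (next u) x) twisted ⟩
    base (next u) y   ≡⟨ base-next y u arc ⟩
    lookup y u        ∎
    where
    open ≡-Reasoning
    twisted : twist (quiet (next u) x) (base (next u) x) ≡ twist (quiet (next u) x) (base (next u) y)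
    twisted = begin
      twist (quiet (next u) x) (base (next u) x) ≡⟨ lookup-F x (next u) ⟨
      lookup (F x) (next u)                      ≡⟨ e ⟩
      lookup (F y) (next u)                      ≡⟨ lookup-F y (next u) ⟩
      twist (quiet (next u) y) (base (next u) y)
        ≡⟨ cong (λ b → twist b (base (next u) y)) (quiet-cong (next u) x y (λ w _ _ → x~y w)) ⟨
      twist (quiet (next u) x) (base (next u) y) ∎

  iter-suc : ∀ s x → iter F (suc s) x ≡ iter F s (F x)
  iter-suc zero    x = refl
  iter-suc (suc s) x = cong F (iter-suc s x)

  -- Twists preserve zeros, so the vanishing of a letter travels unchanged along the arcs of `π` and
  -- can be read off at the end.
  zeros-orbit : ∀ s x u → good s u ≡ true → zeros (iter F s x) (orbit s u) ≡ zeros x u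
  zeros-orbit zero    x u g = refl
  zeros-orbit (suc s) x u g with arc , g' ← ∧-true {D u (next u)} g = begin
    zeros (iter F (suc s) x) (orbit (suc s) u)  ≡⟨ cong (λ z → zeros z (orbit (suc s) u)) (iter-suc s x) ⟩
    zeros (iter F s (F x)) (orbit s (next u))   ≡⟨ zeros-orbit s (F x) (next u) g' ⟩
    zeros (F x) (next u)                        ≡⟨ zeros-F x (next u) ⟩
    isZero (base (next u) x)                    ≡⟨ cong isZero (base-next x u arc) ⟩
    zeros x u                                   ∎
    where open ≡-Reasoning

  orbit-reflects : ∀ s {x y} → zeros x ≗ zeros y → ∀ u → good s u ≡ true →
                   lookup (iter F s x) (orbit s u) ≡ lookup (iter F s y) (orbit s u) →
                   lookup x u ≡ lookup y u
  orbit-reflects zero    x~y u g e = e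
  orbit-reflects (suc s) {x} {y} x~y u g e with arc , g' ← ∧-true {D u (next u)} g =
    F-reflects {x} {y} x~y u arc (orbit-reflects s {F x} {F y} (~-F {x} {y} x~y) (next u) g'
      (subst₂ (λ a b → lookup a (orbit (suc s) u) ≡ lookup b (orbit (suc s) u))
        (iter-suc s x) (iter-suc s y) e))

  module _ (p : ℕ) where

    spread : ∀ b → (Fin (bit b) → Fin q′) → Fin q′
    spread true  h = h zero
    spread false h = one

    spread-≡ : ∀ b h j → spread b h ≡ h j
    spread-≡ true h zero = refl

    -- A word fills the good starting vertices; all other vertices receive the fixed letter `one`,
    -- so any two embedded words agree there.
    embed : (Fin (sum (size p)) → Fin q′) → Config q′ n
    embed a = tabulate (λ u → spread (good p u) (λ j → a (encode (size p) (u , j))))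

    lookup-embed : ∀ a u → lookup (embed a) u ≡ spread (good p u) (λ j → a (encode (size p) (u , j)))
    lookup-embed a u = lookup∘tabulate _ u

    lookup-embed-decode : ∀ a i → lookup (embed a) (proj₁ (decode (size p) i)) ≡ a i
    lookup-embed-decode a i with decode (size p) i in eq
    ... | u , j = trans (lookup-embed a u) (trans (spread-≡ (good p u) _ j)
      (cong a (trans (cong (encode (size p)) (sym eq)) (encode-decode (size p) i))))

    embed-determined : ∀ a b → iter F p (embed a) ≡ iter F p (embed b) → a ≗ b
    embed-determined a b e i = begin
      a i                                            ≡⟨ lookup-embed-decode a i ⟨
      lookup (embed a) (proj₁ (decode (size p) i))
        ≡⟨ orbit-reflects p {embed a} {embed b} same-zeros _ (inhabited-bit (proj₂ (decode (size p) i)))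
             (cong (λ z → lookup z (orbit p (proj₁ (decode (size p) i)))) e) ⟩
      lookup (embed b) (proj₁ (decode (size p) i))   ≡⟨ lookup-embed-decode b i ⟩
      b i                                            ∎
      where
      open ≡-Reasoning
      -- Twists cancel only once the zeros agree: at good vertices the final states reveal them,
      -- elsewhere both states are `one`.
      same-zeros : zeros (embed a) ≗ zeros (embed b)
      same-zeros u with good p u in g
      ... | true  = trans (sym (zeros-orbit p (embed a) u g))
                      (trans (cong (λ z → zeros z (orbit p u)) e) (zeros-orbit p (embed b) u g))
      ... | false = cong isZero (trans (lone a) (sym (lone b)))
        where
        lone : ∀ c → lookup (embed c) u ≡ one
        lone c = trans (lookup-embed c u) (spread-false _ g)
          where
          spread-false : ∀ {b} h → b ≡ false → spread b h ≡ one
          spread-false h refl = refl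

    imageSize-≥-good : q′ ^ sum (size p) ≤ imageSize (iter F p)
    imageSize-≥-good = imageSize-≥ (iter F p) embed embed-determined

  F-sub : IGSub F D
  F-sub u v (x , a , differs) with D u v in arc
  ... | true  = refl
  ... | false = contradiction same differs
    where
    untouched : ∀ w → Arc D w v → lookup x w ≡ lookup (x [ u ]≔ a) w
    untouched w arc' = sym (lookup∘update′ (λ { refl → false≢true arc arc' }) x a)
    same-base : base v x ≡ base v (x [ u ]≔ a)
    same-base with D (pre v) v in arc'
    ... | true  = untouched (pre v) arc'
    ... | false = refl
    same : lookup (F x) v ≡ lookup (F (x [ u ]≔ a)) v
    same = begin
      lookup (F x) v                       ≡⟨ lookup-F x v ⟩
      twist (quiet v x) (base v x)
        ≡⟨ cong₂ twist (quiet-cong v x (x [ u ]≔ a) (λ w arc' _ → cong isZero (untouched w arc'))) same-base ⟩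
      twist (quiet v (x [ u ]≔ a)) (base v (x [ u ]≔ a)) ≡⟨ lookup-F (x [ u ]≔ a) v ⟨
      lookup (F (x [ u ]≔ a)) v            ∎
      where open ≡-Reasoning

  module _ (σ-one : σ one ≢ one) where

    -- Changing the predecessor from 0 to 1 changes whether the value at `v` vanishes, whichever
    -- twist applies.
    depends-on-pre : ∀ v → Arc D (pre v) v → DependsOn F (pre v) v
    depends-on-pre v arc = x , one , λ e → case-zero (trans (sym zero-x) (trans (cong isZero e) zero-y))
      where
      x : Config q′ n
      x = replicate n zero
      case-zero : true ≢ false
      case-zero ()
      zero-base : ∀ x → zeros (F x) v ≡ zeros x (pre v)
      zero-base x = trans (zeros-F x v) (cong (λ b → isZero (if b then lookup x (pre v) else one)) arc)
      zero-x : zeros (F x) v ≡ true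
      zero-x = trans (zero-base x) (cong isZero (lookup-replicate (pre v) zero))
      zero-y : zeros (F (x [ pre v ]≔ one)) v ≡ false
      zero-y = trans (zero-base (x [ pre v ]≔ one)) (cong isZero (lookup∘update (pre v) x one))

    -- With 1 at `pre v` and 0 elsewhere `v` is quiet and gets `σ one`; raising `u` to 1 ends the
    -- quiet and leaves `one`.
    depends-on-other : ∀ u v → Arc D u v → u ≢ pre v → DependsOn F u v
    depends-on-other u v arc u≢pre = x , one , λ e → σ-one (trans (sym Fx) (trans e Fy))
      where
      x y : Config q′ n
      x = replicate n zero [ pre v ]≔ one
      y = x [ u ]≔ one
      base-one : ∀ z → lookup z (pre v) ≡ one → base v z ≡ one
      base-one z e with D (pre v) v
      ... | true  = e
      ... | false = refl
      quiet-x : quiet v x ≡ true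
      quiet-x = dec-true (quiet? v (zeros x)) (λ w _ w≢pre → cong isZero
        (trans (lookup∘update′ w≢pre (replicate n zero) one) (lookup-replicate w zero)))
      quiet-y : quiet v y ≡ false
      quiet-y = dec-false (quiet? v (zeros y)) (λ Q →
        false≢true (cong isZero (lookup∘update u x one)) (Q u arc u≢pre))
      pre-x : lookup x (pre v) ≡ one
      pre-x = lookup∘update (pre v) (replicate n zero) one
      Fx : lookup (F x) v ≡ σ one
      Fx = trans (lookup-F x v) (cong₂ twist quiet-x (base-one x pre-x))
      Fy : lookup (F y) v ≡ one
      Fy = trans (lookup-F y v) (cong₂ twist quiet-y
             (base-one y (trans (lookup∘update′ (u≢pre ∘ sym) x one) pre-x)))

    F-eq : IGEq F D
    F-eq u v = mk⇔ (F-sub u v) depends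
      where
      depends : Arc D u v → DependsOn F u v
      depends arc with u ≟ pre v
      ... | yes refl  = depends-on-pre v arc
      ... | no  u≢pre = depends-on-other u v arc u≢pre

-- The transposition of 1 and 2, and the two alphabet cases.

swap₁₂ : ∀ {r} → Fin (suc (suc (suc r))) → Fin (suc (suc (suc r)))
swap₁₂ (suc zero)       = suc (suc zero)
swap₁₂ (suc (suc zero)) = suc zero
swap₁₂ a                = a

swap₁₂-involutive : ∀ {r} (a : Fin (suc (suc (suc r)))) → swap₁₂ (swap₁₂ a) ≡ a
swap₁₂-involutive zero                = refl
swap₁₂-involutive (suc zero)          = refl
swap₁₂-involutive (suc (suc zero))    = refl
swap₁₂-involutive (suc (suc (suc a))) = refl

swap₁₂-injective : ∀ {r} → Injective _≡_ _≡_ (swap₁₂ {r})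
swap₁₂-injective e = trans (sym (swap₁₂-involutive _)) (trans (cong swap₁₂ e) (swap₁₂-involutive _))

isZero-swap₁₂ : ∀ {r} (a : Fin (suc (suc (suc r)))) → isZero (swap₁₂ a) ≡ isZero a
isZero-swap₁₂ zero                = refl
isZero-swap₁₂ (suc zero)          = refl
isZero-swap₁₂ (suc (suc zero))    = refl
isZero-swap₁₂ (suc (suc (suc a))) = refl

theorem2 : ∀ {n} (D : Digraph n) (p : ℕ) → 1 ≤ p → (k : ℕ) → IsAlpha D p k →
    ((q : ℕ) → 3 ≤ q →
    ((f : Map q n) → IGSub f D → imageSize (iter f p) ≤ q ^ k)
    × (∃ λ (f : Map q n) → IGEq f D × imageSize (iter f p) ≡ q ^ k))
    × (((f : Map 2 n) → IGSub f D → imageSize (iter f p) ≤ 2 ^ k)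
    × (∃ λ (f : Map 2 n) → IGSub f D × imageSize (iter f p) ≡ 2 ^ k))
theorem2 {n} D (suc p') (s≤s z≤n) k alpha = large , upper , T₂.F , T₂.F-sub ,
    ≤-antisym (upper T₂.F T₂.F-sub) (lower {2} (T₂.imageSize-≥-good p))
  where
  open Duality D p'
  upper : ∀ {q} (f : Map q n) → IGSub f D → imageSize (iter f p) ≤ q ^ k
  upper {q} f sub = subst (λ m → imageSize (iter f p) ≤ q ^ m) (cut≡α alpha) (imageSize-≤-cut f sub)
  lower : ∀ {q m} → q ^ sum (size p) ≤ m → q ^ k ≤ m
  lower {q} {m} = subst (λ l → q ^ l ≤ m) (good≡α alpha)
  -- Over two letters the only permutation fixing 0 is the identity, so vertices merely copy, and
  -- only containment in `D` is claimed.
  module T₂ = Twisted D π 0 id id (λ _ → refl)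
  large : (q : ℕ) → 3 ≤ q →
    ((f : Map q n) → IGSub f D → imageSize (iter f p) ≤ q ^ k)
    × (∃ λ (f : Map q n) → IGEq f D × imageSize (iter f p) ≡ q ^ k)
  -- A third letter allows `σ` to fix 0 and move 1; `λ ()` refutes 2 = 1.
  large (suc (suc (suc r))) (s≤s (s≤s (s≤s z≤n))) = upper , T.F , T.F-eq (λ ()) ,
    ≤-antisym (upper T.F T.F-sub) (lower {3 + r} (T.imageSize-≥-good p))
    where
    module T = Twisted D π (suc r) swap₁₂ swap₁₂-injective isZero-swap₁₂
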